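{- Let $n\ge 2$, $t\in[n-1]$ and $I=\{t,t+1,\ldots,n-1\}\subset[n-1]$. Then $\mathrm{ASM}^I(n)$ is in bijection with the set of monotone triangles of size $t-1$ with all entries in $\{1,\dots,n\}$.
   Context: $[m]=\{1,\dots,m\}$. An alternating sign matrix (ASM) is a square matrix with entries in $\{0,1,-1\}$ such that the nonzero entries in each row and each column alternate in sign and each row and each column sums to $1$; $\mathrm{ASM}(n)$ is the set of $n\times n$ ASMs. The rank matrix of $A$ is $r_A(i,j)=\sum_{p=1}^i\sum_{q=1}^jA_{p,q}$, with $r_A(0,j)=r_A(i,0)=0$. $\mathrm{ASM}^I(n):=\{A\in\mathrm{ASM}(n)\mid r_A(i,j)\in\{r_A(i-1,j)+1,\ r_A(i+1,j)\}\text{ for all }i\in I,\ j\in[n]\}$. A monotone triangle of size $m$ is a triangular array of integers $(m_{i,j})_{1\le j\le i\le m}$ such that $m_{i,j}\le m_{i-1,j}\le m_{i,j+1}$ for all $1\le j<i\le m$ and $m_{i,j}<m_{i,j+1}$ for all $1\le j<i\le m$. (For size $0$ there is exactly one, the empty triangle.) -}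

module Defs where

open import Data.Bool.Base using (if_then_else_; _∧_)
open import Data.Fin.Base as Fin using (Fin; toℕ)
open import Data.Integer.Base using (ℤ; +_; 0ℤ; 1ℤ; -1ℤ; sign; _+_)
  renaming (_≤_ to _≤ᶻ_; _<_ to _<ᶻ_)
open import Data.Integer.Properties using (+-0-commutativeMonoid)
open import Data.Nat.Base using (ℕ; suc; _∸_; _≤_; _<_; _≤ᵇ_)
open import Data.Product.Base using (_×_)
open import Data.Sign.Base using (opposite)
open import Data.Sum.Base using (_⊎_)
open import Data.Vec.Functional using (Vector; transpose)
import Data.Vec.Functional.Relation.Binary.Equality.Setoid as VectorEq
open import Level using (0ℓ)
open import Relation.Binary.Bundles using (Setoid)
import Relation.Binary.Construct.On as On
open import Relation.Binary.PropositionalEquality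
  using (_≡_; _≢_; refl; sym; trans; setoid)
open import Relation.Unary using (Pred; _∈_)

open import Algebra.Properties.CommutativeMonoid.Sum +-0-commutativeMonoid
  using (sum)

-- Fin m stands for [m] = {1,…,m}; pos k is the element of [m] encoded by k.
pos : ∀ {m} → Fin m → ℕ
pos k = suc (toℕ k)

Matrix : ℕ → Set
Matrix n = Vector (Vector ℤ n) n

-- Any two consecutive nonzero entries have opposite signs.  (The stdlib
-- assigns 0 the sign +, but sign is only compared on nonzero entries here.)
Alternates : ∀ {n} → Vector ℤ n → Set
Alternates {n} v = (a b : Fin n) → a Fin.< b → v a ≢ 0ℤ → v b ≢ 0ℤ →
  ((c : Fin n) → a Fin.< c → c Fin.< b → v c ≡ 0ℤ) →
  sign (v b) ≡ opposite (sign (v a))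

record IsASM {n : ℕ} (A : Matrix n) : Set where
  field
    entries       : ∀ p q → A p q ≡ 0ℤ ⊎ A p q ≡ 1ℤ ⊎ A p q ≡ -1ℤ
    row-alternate : ∀ p → Alternates (A p)
    col-alternate : ∀ q → Alternates (transpose A q)
    row-sum       : ∀ p → sum (A p) ≡ 1ℤ
    col-sum       : ∀ q → sum (transpose A q) ≡ 1ℤ

-- The sum of A over 1 ≤ p ≤ i, 1 ≤ q ≤ j, for 0 ≤ i , j ≤ n.
rank : ∀ {n} → Matrix n → ℕ → ℕ → ℤ
rank A i j = sum λ p → sum λ q →
  if (pos p ≤ᵇ i) ∧ (pos q ≤ᵇ j) then A p q else 0ℤ

record ASM^ (n : ℕ) (I : Pred (Fin (n ∸ 1)) 0ℓ) : Set where
  field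
    matrix : Matrix n
    isASM  : IsASM matrix
    rank-I : ∀ i → i ∈ I → (j : Fin n) →
      rank matrix (pos i) (pos j) ≡ rank matrix (pos i ∸ 1) (pos j) + 1ℤ ⊎
      rank matrix (pos i) (pos j) ≡ rank matrix (suc (pos i)) (pos j)

matrixSetoid : ℕ → Setoid 0ℓ 0ℓ
matrixSetoid n = VectorEq.≋-setoid (VectorEq.≋-setoid (setoid ℤ) n) n

-- Elements are identified when their matrices agree entrywise.
ASM^-setoid : (n : ℕ) → Pred (Fin (n ∸ 1)) 0ℓ → Setoid 0ℓ 0ℓ
ASM^-setoid n I = On.setoid (matrixSetoid n) (ASM^.matrix {n} {I})

-- The subset {t, …, n-1} of [n-1].
interval : (n t : ℕ) → Pred (Fin (n ∸ 1)) 0ℓ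
interval n t i = t ≤ pos i × pos i ≤ n ∸ 1

-- A triangular array of size m is represented by a function on all of ℕ × ℕ,
-- of which only the values at 1 ≤ j ≤ i ≤ m are meaningful: every condition,
-- and the equality of the setoid below, refers to these values only.
record IsMonotoneTriangle (m : ℕ) (T : ℕ → ℕ → ℤ) : Set where
  field
    interlace : ∀ i j → 1 ≤ j → j < i → i ≤ m →
      T i j ≤ᶻ T (i ∸ 1) j × T (i ∸ 1) j ≤ᶻ T i (suc j)
    increase  : ∀ i j → 1 ≤ j → j < i → i ≤ m → T i j <ᶻ T i (suc j)

record MonotoneTriangle (m n : ℕ) : Set where
  field
    entry      : ℕ → ℕ → ℤ
    isMonotone : IsMonotoneTriangle m entry
    bounded    : ∀ i j → 1 ≤ j → j ≤ i → i ≤ m →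
      1ℤ ≤ᶻ entry i j × entry i j ≤ᶻ + n

MonotoneTriangle-setoid : (m n : ℕ) → Setoid 0ℓ 0ℓ
MonotoneTriangle-setoid m n = record
  { Carrier       = MonotoneTriangle m n
  ; _≈_           = λ S T → ∀ i j → 1 ≤ j → j ≤ i → i ≤ m →
                    MonotoneTriangle.entry S i j ≡ MonotoneTriangle.entry T i j
  ; isEquivalence = record
    { refl  = λ _ _ _ _ _ → refl
    ; sym   = λ e i j p q r → sym (e i j p q r)
    ; trans = λ e f i j p q r → trans (e i j p q r) (f i j p q r)
    }
  }

{-# OPTIONS --safe #-}
-- An ASM is the same as its corner sum matrix r, whose rows and columns increase
-- by steps 0 or 1 from 0 to r(n,j) = j and r(i,n) = i.  Row i of the monotone
-- triangle and row i of r determine each other by T(i,k) ≤ j ⇔ k ≤ r(i,j), and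
-- interlacing says exactly that r has steps 0 or 1 between consecutive rows.
-- The rank condition says that, for i ≥ t, column j of r cannot increase again
-- after a step 0; as it ends at r(n,j) = j, this forces
-- r(i,j) = min (r(t-1,j) + i - (t-1), j) for i ≥ t-1.  So r is determined by its
-- first t-1 rows, and conversely the formula extends any t-1 admissible rows.
module Submission where

open import Defs
open import Algebra.Bundles using (AbelianGroup)
open import Algebra.Properties.CommutativeMonoid.Sum using (∑-comm; sum-cong-≗; sum-replicate-zero)
import Algebra.Properties.Group as GroupProperties
open import Data.Bool.Base using (Bool; true; false; if_then_else_; _∧_)
open import Data.Bool.Properties using (∧-comm)
open import Data.Fin.Base as Fin using (Fin; zero; suc; toℕ; fromℕ<)
import Data.Fin.Properties as Fin
open import Data.Integer.Base as ℤ using (ℤ; +_; 0ℤ; 1ℤ; -1ℤ; sign)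
import Data.Integer.Properties as ℤ
import Data.Integer.Tactic.RingSolver as ℤ-Solver
open import Data.Nat.Base
open import Data.Nat.Properties
open import Data.Product.Base using (Σ; _×_; _,_; ∃; proj₁; proj₂)
open import Data.Sign.Base using (opposite)
open import Data.Sum.Base using (_⊎_; inj₁; inj₂)
open import Data.Vec.Functional using (Vector; transpose; tail)
open import Function.Base using (_∘_)
open import Function.Bundles using (Bijection)
open import Relation.Binary.Bundles using (Setoid)
open import Relation.Binary.PropositionalEquality
open import Relation.Nullary using (yes; no; contradiction)

open import Algebra.Properties.CommutativeMonoid.Sum ℤ.+-0-commutativeMonoid
  using (sum)

private
  variable
    n : ℕ

-- Prefix sums of integer vectors

prefix : Vector ℤ n → ℕ → ℤ
prefix v k = sum λ q → if pos q ≤ᵇ k then v q else 0ℤ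

prefix-zero : (v : Vector ℤ n) → prefix v 0 ≡ 0ℤ
prefix-zero {n} _ = sum-replicate-zero ℤ.+-0-commutativeMonoid n

prefix-all : (v : Vector ℤ n) → prefix v n ≡ sum v
prefix-all {zero}  v = refl
prefix-all {suc n} v = cong (ℤ._+_ (v zero)) (prefix-all (tail v))

prefix-cong : {v w : Vector ℤ n} → v ≗ w → prefix v ≗ prefix w
prefix-cong v≗w k = sum-cong-≗ ℤ.+-0-commutativeMonoid λ q →
  cong (λ x → if pos q ≤ᵇ k then x else 0ℤ) (v≗w q)

prefix-toℕ : (v : Vector ℤ n) (q : Fin n) →
  prefix v (suc (toℕ q)) ≡ prefix v (toℕ q) ℤ.+ v q
prefix-toℕ v zero    = begin
  v zero ℤ.+ prefix (tail v) 0   ≡⟨ cong (ℤ._+_ (v zero)) (prefix-zero (tail v)) ⟩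
  v zero ℤ.+ 0ℤ                  ≡⟨ ℤ.+-comm (v zero) 0ℤ ⟩
  0ℤ ℤ.+ v zero                  ≡⟨ cong (ℤ._+ v zero) (prefix-zero v) ⟨
  prefix v 0 ℤ.+ v zero          ∎
  where open ≡-Reasoning
prefix-toℕ v (suc q) = begin
  v zero ℤ.+ prefix (tail v) (suc (toℕ q))          ≡⟨ cong (ℤ._+_ (v zero)) (prefix-toℕ (tail v) q) ⟩
  v zero ℤ.+ (prefix (tail v) (toℕ q) ℤ.+ v (suc q)) ≡⟨ ℤ.+-assoc (v zero) _ _ ⟨
  v zero ℤ.+ prefix (tail v) (toℕ q) ℤ.+ v (suc q)   ∎
  where open ≡-Reasoning

prefix-suc : (v : Vector ℤ n) {k : ℕ} (k<n : k < n) →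
  prefix v (suc k) ≡ prefix v k ℤ.+ v (fromℕ< k<n)
prefix-suc v k<n = subst
  (λ k → prefix v (suc k) ≡ prefix v k ℤ.+ v (fromℕ< k<n))
  (Fin.toℕ-fromℕ< k<n) (prefix-toℕ v (fromℕ< k<n))

prefix-telescope : (v : Vector ℤ n) (f : ℕ → ℤ) → f 0 ≡ 0ℤ →
  (∀ q → v q ≡ f (suc (toℕ q)) ℤ.- f (toℕ q)) → ∀ {k} → k ≤ n → prefix v k ≡ f k
prefix-telescope v f f0 v≡Δf {zero}  k≤n = trans (prefix-zero v) (sym f0)
prefix-telescope v f f0 v≡Δf {suc k} k<n = begin
  prefix v (suc k)                       ≡⟨ prefix-suc v k<n ⟩
  prefix v k ℤ.+ v (fromℕ< k<n)          ≡⟨ cong₂ ℤ._+_ (prefix-telescope v f f0 v≡Δf (<⇒≤ k<n)) (v≡Δf _) ⟩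
  f k ℤ.+ (f (suc (toℕ (fromℕ< k<n))) ℤ.- f (toℕ (fromℕ< k<n)))
    ≡⟨ cong (λ l → f k ℤ.+ (f (suc l) ℤ.- f l)) (Fin.toℕ-fromℕ< k<n) ⟩
  f k ℤ.+ (f (suc k) ℤ.- f k)            ≡⟨ cancel (f k) (f (suc k)) ⟩
  f (suc k)                              ∎
  where
  open ≡-Reasoning
  cancel : ∀ x y → x ℤ.+ (y ℤ.- x) ≡ y
  cancel = ℤ-Solver.solve-∀

1+x-x≡1 : ∀ x → 1ℤ ℤ.+ x ℤ.- x ≡ 1ℤ
1+x-x≡1 = ℤ-Solver.solve-∀

+-cancelˡ : ∀ x {y z} → x ℤ.+ y ≡ x ℤ.+ z → y ≡ z
+-cancelˡ x = GroupProperties.∙-cancelˡ (AbelianGroup.group ℤ.+-0-abelianGroup) x _ _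

prefix-injective : {v w : Vector ℤ n} →
  (∀ {k} → k ≤ n → prefix v k ≡ prefix w k) → v ≗ w
prefix-injective {v = v} {w} eq q = +-cancelˡ (prefix v (toℕ q)) (begin
  prefix v (toℕ q) ℤ.+ v q  ≡⟨ prefix-toℕ v q ⟨
  prefix v (suc (toℕ q))    ≡⟨ eq (Fin.toℕ<n q) ⟩
  prefix w (suc (toℕ q))    ≡⟨ prefix-toℕ w q ⟩
  prefix w (toℕ q) ℤ.+ w q  ≡⟨ cong (ℤ._+ w q) (eq (<⇒≤ (Fin.toℕ<n q))) ⟨
  prefix v (toℕ q) ℤ.+ w q  ∎)
  where open ≡-Reasoning

-- Alternating signs and prefix sums in {0, 1}

Bit : ℤ → Set
Bit x = x ≡ 0ℤ ⊎ x ≡ 1ℤ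

Ternary : ℤ → Set
Ternary x = x ≡ 0ℤ ⊎ x ≡ 1ℤ ⊎ x ≡ -1ℤ

opposite-sum : ∀ {x y} → Ternary x → x ≢ 0ℤ → Ternary y → y ≢ 0ℤ →
  sign y ≡ opposite (sign x) → x ℤ.+ y ≡ 0ℤ
opposite-sum (inj₁ x0) x≢0 _ _ _ = contradiction x0 x≢0
opposite-sum (inj₂ _) _ (inj₁ y0) y≢0 _ = contradiction y0 y≢0
opposite-sum (inj₂ (inj₁ refl)) _ (inj₂ (inj₁ refl)) _ ()
opposite-sum (inj₂ (inj₁ refl)) _ (inj₂ (inj₂ refl)) _ _ = refl
opposite-sum (inj₂ (inj₂ refl)) _ (inj₂ (inj₁ refl)) _ _ = refl
opposite-sum (inj₂ (inj₂ refl)) _ (inj₂ (inj₂ refl)) _ ()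

alternates-tail : {v : Vector ℤ (suc n)} → Alternates v → Alternates (tail v)
alternates-tail alt a b a<b va vb between =
  alt (suc a) (suc b) (s<s a<b) va vb λ { (suc c) a<c c<b → between c (s<s⁻¹ a<c) (s<s⁻¹ c<b) }

Leading : (v : Vector ℤ n) → Fin n → Set
Leading v b = v b ≢ 0ℤ × (∀ c → c Fin.< b → v c ≡ 0ℤ)

-- Prepending `x` to a tail whose first nonzero entry is `- x` turns the partial sums 0 and `- x`
-- into `x` and 0. Tracking the first nonzero entry keeps the induction free of a condition on the
-- total, which tails do not inherit.
alternates⇒prefix-leading : (v : Vector ℤ n) → (∀ q → Ternary (v q)) → Alternates v →
  (∀ k → prefix v k ≡ 0ℤ) ⊎
  ∃ λ b → Leading v b × (∀ k → prefix v k ≡ 0ℤ ⊎ prefix v k ≡ v b)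
alternates⇒prefix-leading {zero}  v ter alt = inj₁ λ _ → refl
alternates⇒prefix-leading {suc n} v ter alt
  with v zero ℤ.≟ 0ℤ | alternates⇒prefix-leading (tail v) (ter ∘ suc) (alternates-tail alt)
... | yes v0 | inj₁ none = inj₁ λ
  { zero    → prefix-zero v
  ; (suc k) → cong₂ ℤ._+_ v0 (none k) }
... | yes v0 | inj₂ (b , (vb , before) , range) = inj₂
  ( suc b
  , (vb , λ { zero _ → v0 ; (suc c) c<b → before c (s<s⁻¹ c<b) })
  , λ { zero    → inj₁ (prefix-zero v)
      ; (suc k) → subst (λ x → x ≡ 0ℤ ⊎ x ≡ v (suc b))
          (sym (trans (cong (ℤ._+ prefix (tail v) k) v0) (ℤ.+-identityˡ _))) (range k) } )
... | no v0 | inj₁ none = inj₂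
  ( zero , (v0 , λ _ ())
  , λ { zero    → inj₁ (prefix-zero v)
      ; (suc k) → inj₂ (trans (cong (ℤ._+_ (v zero)) (none k)) (ℤ.+-identityʳ _)) } )
... | no v0 | inj₂ (b , (vb , before) , range) = inj₂
  ( zero , (v0 , λ _ ())
  , λ { zero → inj₁ (prefix-zero v) ; (suc k) → step (range k) } )
  where
  step : ∀ {x} → x ≡ 0ℤ ⊎ x ≡ v (suc b) → v zero ℤ.+ x ≡ 0ℤ ⊎ v zero ℤ.+ x ≡ v zero
  step (inj₁ refl) = inj₂ (ℤ.+-identityʳ _)
  step (inj₂ refl) = inj₁ (opposite-sum (ter zero) v0 (ter (suc b)) vb
    (alt zero (suc b) z<s v0 vb λ { (suc c) _ c<b → before c (s<s⁻¹ c<b) }))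

-- The total is itself a partial sum, so a first nonzero entry -1 would put 1 into {0, -1}.
alternates⇒prefix-bit : (v : Vector ℤ n) → (∀ q → Ternary (v q)) → Alternates v →
  sum v ≡ 1ℤ → ∀ k → Bit (prefix v k)
alternates⇒prefix-bit {n} v ter alt total k with alternates⇒prefix-leading v ter alt
... | inj₁ none = inj₁ (none k)
... | inj₂ (b , (vb , _) , range) with ter b
...   | inj₁ vb≡0 = contradiction vb≡0 vb
...   | inj₂ (inj₁ vb≡1) = subst (λ x → prefix v k ≡ 0ℤ ⊎ prefix v k ≡ x) vb≡1 (range k)
...   | inj₂ (inj₂ vb≡-1) with trans (sym total) (sym (prefix-all v)) | range n
...     | total′ | inj₁ e = contradiction (trans total′ e) λ ()
...     | total′ | inj₂ e = contradiction (trans total′ (trans e vb≡-1)) λ ()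

bit-difference : ∀ {x y z} → y ≡ x ℤ.+ z → Bit x → Bit y → Ternary z
bit-difference eq (inj₁ refl) (inj₁ refl) = inj₁ (+-cancelˡ 0ℤ (sym eq))
bit-difference eq (inj₁ refl) (inj₂ refl) = inj₂ (inj₁ (+-cancelˡ 0ℤ (sym eq)))
bit-difference eq (inj₂ refl) (inj₁ refl) = inj₂ (inj₂ (+-cancelˡ 1ℤ (sym eq)))
bit-difference eq (inj₂ refl) (inj₂ refl) = inj₁ (+-cancelˡ 1ℤ (sym eq))

-- Here `x`, `x′` and `x′ + z` are the partial sums around consecutive nonzero entries `y` and `z`.
-- A nonzero step within {0, 1} flips the value, and two flips in a row go in opposite directions.
bit-alternation : ∀ {x y x′ z} → x′ ≡ x ℤ.+ y → z ≢ 0ℤ → y ≢ 0ℤ →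
  Bit x → Bit x′ → Bit (x′ ℤ.+ z) → sign z ≡ opposite (sign y)
bit-alternation {y = y} {z = z} eq z≢0 y≢0 (inj₁ refl) (inj₁ refl) _ =
  contradiction (+-cancelˡ 0ℤ (sym eq)) y≢0
bit-alternation eq z≢0 y≢0 (inj₂ refl) (inj₂ refl) _ =
  contradiction (+-cancelˡ 1ℤ (sym eq)) y≢0
bit-alternation {y = y} {z = z} eq z≢0 y≢0 (inj₁ refl) (inj₂ refl) bit
  with refl ← +-cancelˡ 0ℤ {y} {1ℤ} (sym eq) with bit
... | inj₁ e with refl ← +-cancelˡ 1ℤ {z} { -1ℤ} e = refl
... | inj₂ e = contradiction (+-cancelˡ 1ℤ e) z≢0
bit-alternation {y = y} {z = z} eq z≢0 y≢0 (inj₂ refl) (inj₁ refl) bit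
  with refl ← +-cancelˡ 1ℤ {y} { -1ℤ} (sym eq) with bit
... | inj₁ e = contradiction (+-cancelˡ 0ℤ e) z≢0
... | inj₂ e with refl ← +-cancelˡ 0ℤ {z} {1ℤ} e = refl

prefix-bit⇒ternary : (v : Vector ℤ n) → (∀ {k} → k ≤ n → Bit (prefix v k)) →
  ∀ q → Ternary (v q)
prefix-bit⇒ternary v bits q = bit-difference (prefix-toℕ v q)
  (bits (<⇒≤ (Fin.toℕ<n q))) (bits (Fin.toℕ<n q))

prefix-constant : (v : Vector ℤ n) {k : ℕ} (b : Fin n) →
  (∀ c → k ≤ toℕ c → c Fin.< b → v c ≡ 0ℤ) →
  ∀ d → d + k ≤ toℕ b → prefix v (d + k) ≡ prefix v k
prefix-constant v b zeros zero    _     = refl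
prefix-constant {n} v {k} b zeros (suc d) d+k<b = begin
  prefix v (suc (d + k))                ≡⟨ prefix-suc v d+k<n ⟩
  prefix v (d + k) ℤ.+ v (fromℕ< d+k<n) ≡⟨ cong₂ ℤ._+_ (prefix-constant v b zeros d (<⇒≤ d+k<b)) vanishes ⟩
  prefix v k ℤ.+ 0ℤ                     ≡⟨ ℤ.+-identityʳ _ ⟩
  prefix v k                            ∎
  where
  open ≡-Reasoning
  d+k<n : d + k < n
  d+k<n = <-trans d+k<b (Fin.toℕ<n b)
  vanishes : v (fromℕ< d+k<n) ≡ 0ℤ
  vanishes = zeros _ (subst (k ≤_) (sym (Fin.toℕ-fromℕ< d+k<n)) (m≤n+m k d))
    (subst (_< toℕ b) (sym (Fin.toℕ-fromℕ< d+k<n)) d+k<b)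

-- The zeros between `a` and `b` keep the prefix sum constant, so the value just before `b` is the
-- one just after `a`, as `bit-alternation` requires.
prefix-bit⇒alternates : (v : Vector ℤ n) → (∀ {k} → k ≤ n → Bit (prefix v k)) →
  Alternates v
prefix-bit⇒alternates v bits a b a<b va vb between =
  bit-alternation {x = prefix v (toℕ a)} (prefix-toℕ v a) vb va
    (bits (<⇒≤ (Fin.toℕ<n a))) (bits (Fin.toℕ<n a))
    (subst Bit jump (bits (Fin.toℕ<n b)))
  where
  gap : prefix v (toℕ b) ≡ prefix v (suc (toℕ a))
  gap = subst (λ k → prefix v k ≡ prefix v (suc (toℕ a))) (m∸n+n≡m a<b)
    (prefix-constant v b between (toℕ b ∸ suc (toℕ a)) (≤-reflexive (m∸n+n≡m a<b)))
  jump : prefix v (suc (toℕ b)) ≡ prefix v (suc (toℕ a)) ℤ.+ v b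
  jump = trans (prefix-toℕ v b) (cong (ℤ._+ v b) gap)

-- Corner sum matrices

Step : ℕ → ℕ → Set
Step a b = a ≤ b × b ≤ suc a

record IsCornerSum (n : ℕ) (r : ℕ → ℕ → ℕ) : Set where
  field
    top    : ∀ {j} → j ≤ n → r 0 j ≡ 0
    left   : ∀ {i} → i ≤ n → r i 0 ≡ 0
    bottom : ∀ {j} → j ≤ n → r n j ≡ j
    right  : ∀ {i} → i ≤ n → r i n ≡ i
    down   : ∀ {i j} → i < n → j ≤ n → Step (r i j) (r (suc i) j)
    across : ∀ {i j} → i ≤ n → j < n → Step (r i j) (r i (suc j))

step-cases : ∀ {a b} → Step a b → b ≡ a ⊎ b ≡ suc a
step-cases {a} (a≤b , b≤1+a) with m≤n⇒m<n∨m≡n b≤1+a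
... | inj₁ (s≤s b≤a) = inj₁ (≤-antisym b≤a a≤b)
... | inj₂ b≡1+a     = inj₂ b≡1+a

step⇒bit : ∀ {a b} → Step a b → Bit (+ b ℤ.- + a)
step⇒bit {a} s with step-cases s
... | inj₁ refl = inj₁ (ℤ.+-inverseʳ (+ a))
... | inj₂ refl = inj₂ (1+x-x≡1 (+ a))

bit⇒step : ∀ {a b x} → Bit x → + b ≡ + a ℤ.+ x → Step a b
bit⇒step {a} (inj₁ refl) eq with refl ← ℤ.+-injective (trans eq (ℤ.+-identityʳ (+ a))) =
  ≤-refl , n≤1+n _
bit⇒step {a} (inj₂ refl) eq with refl ← ℤ.+-injective (trans eq (ℤ.+-comm (+ a) 1ℤ)) =
  n≤1+n _ , ≤-refl

-- Ranks as iterated prefix sums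

sum-guard : ∀ b (c : Fin n → Bool) (v : Vector ℤ n) →
  (sum λ q → if b ∧ c q then v q else 0ℤ) ≡
  (if b then (sum λ q → if c q then v q else 0ℤ) else 0ℤ)
sum-guard     true  c v = refl
sum-guard {n} false c v = sum-replicate-zero ℤ.+-0-commutativeMonoid n

rank-rows : (A : Matrix n) (i j : ℕ) → rank A i j ≡ prefix (λ p → prefix (A p) j) i
rank-rows A i j = sum-cong-≗ ℤ.+-0-commutativeMonoid λ p →
  sum-guard (pos p ≤ᵇ i) (λ q → pos q ≤ᵇ j) (A p)

-- Interchanging the two sums lets facts about columns be read off from facts about rows of the
-- transpose.
rank-transpose : (A : Matrix n) (i j : ℕ) → rank (transpose A) j i ≡ rank A i j
rank-transpose A i j = trans
  (∑-comm ℤ.+-0-commutativeMonoid λ q p → if (pos q ≤ᵇ j) ∧ (pos p ≤ᵇ i) then A p q else 0ℤ)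
  (sum-cong-≗ ℤ.+-0-commutativeMonoid λ p → sum-cong-≗ ℤ.+-0-commutativeMonoid λ q →
    cong (λ b → if b then A p q else 0ℤ) (∧-comm (pos q ≤ᵇ j) (pos p ≤ᵇ i)))

rank-suc : (A : Matrix n) {i : ℕ} (i<n : i < n) (j : ℕ) →
  rank A (suc i) j ≡ rank A i j ℤ.+ prefix (A (fromℕ< i<n)) j
rank-suc A {i} i<n j = begin
  rank A (suc i) j                                          ≡⟨ rank-rows A (suc i) j ⟩
  prefix rows (suc i)                                       ≡⟨ prefix-suc rows i<n ⟩
  prefix rows i ℤ.+ prefix (A (fromℕ< i<n)) j               ≡⟨ cong (ℤ._+ prefix (A (fromℕ< i<n)) j) (rank-rows A i j) ⟨
  rank A i j ℤ.+ prefix (A (fromℕ< i<n)) j                  ∎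
  where
  open ≡-Reasoning
  rows = λ p → prefix (A p) j

rank-zero : (A : Matrix n) (j : ℕ) → rank A 0 j ≡ 0ℤ
rank-zero A j = trans (rank-rows A 0 j) (prefix-zero λ p → prefix (A p) j)

rank-cong : {A B : Matrix n} → (∀ p q → A p q ≡ B p q) → ∀ i j → rank A i j ≡ rank B i j
rank-cong {A = A} {B} A≗B i j = trans (rank-rows A i j)
  (trans (prefix-cong (λ p → prefix-cong (A≗B p) j) i) (sym (rank-rows B i j)))

rank-injective : {A B : Matrix n} →
  (∀ {i j} → i ≤ n → j ≤ n → rank A i j ≡ rank B i j) → ∀ p q → A p q ≡ B p q
rank-injective {A = A} {B} eq p = prefix-injective λ {j} j≤n →
  prefix-injective {v = λ p → prefix (A p) j} {w = λ p → prefix (B p) j}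
    (λ {i} i≤n → trans (sym (rank-rows A i j)) (trans (eq i≤n j≤n) (rank-rows B i j))) p

transpose-isASM : {A : Matrix n} → IsASM A → IsASM (transpose A)
transpose-isASM asm = record
  { entries       = λ p q → entries q p
  ; row-alternate = col-alternate
  ; col-alternate = row-alternate
  ; row-sum       = col-sum
  ; col-sum       = row-sum
  }
  where open IsASM asm

-- From ASMs to corner sum matrices

cornerSum : Matrix n → ℕ → ℕ → ℕ
cornerSum A i j = ℤ.∣ rank A i j ∣

module _ {A : Matrix n} (asm : IsASM A) where
  open IsASM asm

  row-prefix-bit : ∀ p j → Bit (prefix (A p) j)
  row-prefix-bit p = alternates⇒prefix-bit (A p) (entries p) (row-alternate p) (row-sum p)

  rank-nonneg : ∀ {i} → i ≤ n → ∀ j → 0ℤ ℤ.≤ rank A i j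
  rank-nonneg {zero}  _   j = ℤ.≤-reflexive (sym (rank-zero A j))
  rank-nonneg {suc i} i<n j = subst (0ℤ ℤ.≤_) (sym (rank-suc A i<n j))
    (ℤ.+-mono-≤ (rank-nonneg (<⇒≤ i<n) j) (bit-nonneg (row-prefix-bit (fromℕ< i<n) j)))
    where
    bit-nonneg : ∀ {x} → Bit x → 0ℤ ℤ.≤ x
    bit-nonneg (inj₁ refl) = ℤ.+≤+ z≤n
    bit-nonneg (inj₂ refl) = ℤ.+≤+ z≤n

  -- Row prefixes are bits, so ranks are nonnegative and the absolute value in `cornerSum` loses
  -- nothing.
  +cornerSum : ∀ {i} → i ≤ n → ∀ j → + cornerSum A i j ≡ rank A i j
  +cornerSum i≤n j = ℤ.0≤i⇒+∣i∣≡i (rank-nonneg i≤n j)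

  cornerSum-down : ∀ {i} → i < n → ∀ j → Step (cornerSum A i j) (cornerSum A (suc i) j)
  cornerSum-down {i} i<n j = bit⇒step (row-prefix-bit (fromℕ< i<n) j) (begin
    + cornerSum A (suc i) j      ≡⟨ +cornerSum i<n j ⟩
    rank A (suc i) j             ≡⟨ rank-suc A i<n j ⟩
    rank A i j ℤ.+ rowᵢ          ≡⟨ cong (ℤ._+ rowᵢ) (+cornerSum (<⇒≤ i<n) j) ⟨
    + cornerSum A i j ℤ.+ rowᵢ   ∎)
    where
    open ≡-Reasoning
    rowᵢ = prefix (A (fromℕ< i<n)) j

  cornerSum-right : ∀ {i} → i ≤ n → cornerSum A i n ≡ i
  cornerSum-right {i} i≤n = cong ℤ.∣_∣ (trans (rank-rows A i n)
    (prefix-telescope (λ p → prefix (A p) n) (λ k → + k) refl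
      (λ p → trans (trans (prefix-all (A p)) (row-sum p)) (sym (1+x-x≡1 (+ toℕ p)))) i≤n))

cornerSum-isCornerSum : {A : Matrix n} → IsASM A → IsCornerSum n (cornerSum A)
cornerSum-isCornerSum {n} {A} asm = record
  { top    = λ {j} _ → cong ℤ.∣_∣ (rank-zero A j)
  ; left   = λ {i} _ → trans (flip i 0) (cong ℤ.∣_∣ (rank-zero (transpose A) i))
  ; bottom = λ {j} j≤n → trans (flip n j) (cornerSum-right asmᵀ j≤n)
  ; right  = cornerSum-right asm
  ; down   = λ {_} {j} i<n _ → cornerSum-down asm i<n j
  ; across = λ {i} {j} _ j<n → subst₂ Step (sym (flip i j)) (sym (flip i (suc j)))
      (cornerSum-down asmᵀ j<n i)
  }
  where
  asmᵀ = transpose-isASM asm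
  flip : ∀ i j → cornerSum A i j ≡ cornerSum (transpose A) j i
  flip i j = cong ℤ.∣_∣ (sym (rank-transpose A i j))

-- From corner sum matrices to ASMs

mixedDifference : (ℕ → ℕ → ℕ) → Matrix n
mixedDifference r p q =
  (+ r (pos p) (pos q) ℤ.- + r (toℕ p) (pos q)) ℤ.- (+ r (pos p) (toℕ q) ℤ.- + r (toℕ p) (toℕ q))

module _ {r : ℕ → ℕ → ℕ} (corner : IsCornerSum n r) where
  open IsCornerSum corner

  private
    M : Matrix n
    M = mixedDifference r

    Δ↓ Δ→ : ℕ → ℕ → ℤ
    Δ↓ i j = + r (suc i) j ℤ.- + r i j
    Δ→ i j = + r i (suc j) ℤ.- + r i j

    -- An entry of `M` is grouped as the change of `Δ↓` from one column to the next, so row sums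
    -- telescope by `refl`; column sums first need the regrouping `exchange`.
    row-prefix : ∀ p {j} → j ≤ n → prefix (M p) j ≡ Δ↓ (toℕ p) j
    row-prefix p = prefix-telescope (M p) (Δ↓ (toℕ p))
      (cong₂ (λ a b → + a ℤ.- + b) (left (Fin.toℕ<n p)) (left (<⇒≤ (Fin.toℕ<n p))))
      (λ q → refl)

    col-prefix : ∀ q {i} → i ≤ n → prefix (transpose M q) i ≡ Δ→ i (toℕ q)
    col-prefix q = prefix-telescope (transpose M q) (λ i → Δ→ i (toℕ q))
      (cong₂ (λ a b → + a ℤ.- + b) (top (Fin.toℕ<n q)) (top (<⇒≤ (Fin.toℕ<n q))))
      (λ p → exchange (+ r (pos p) (pos q)) (+ r (toℕ p) (pos q))
        (+ r (pos p) (toℕ q)) (+ r (toℕ p) (toℕ q)))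
      where
      exchange : ∀ a b c d → (a ℤ.- b) ℤ.- (c ℤ.- d) ≡ (a ℤ.- c) ℤ.- (b ℤ.- d)
      exchange = ℤ-Solver.solve-∀

    row-bit : ∀ p {j} → j ≤ n → Bit (prefix (M p) j)
    row-bit p j≤n = subst Bit (sym (row-prefix p j≤n)) (step⇒bit (down (Fin.toℕ<n p) j≤n))

    col-bit : ∀ q {i} → i ≤ n → Bit (prefix (transpose M q) i)
    col-bit q i≤n = subst Bit (sym (col-prefix q i≤n)) (step⇒bit (across i≤n (Fin.toℕ<n q)))

    total : ∀ (v : Vector ℤ n) {a b k} → prefix v n ≡ + b ℤ.- + a → a ≡ k → b ≡ suc k →
      sum v ≡ 1ℤ
    total v {k = k} eq refl refl = trans (sym (prefix-all v)) (trans eq (1+x-x≡1 (+ k)))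

  mixedDifference-isASM : IsASM M
  mixedDifference-isASM = record
    { entries       = λ p → prefix-bit⇒ternary (M p) (row-bit p)
    ; row-alternate = λ p → prefix-bit⇒alternates (M p) (row-bit p)
    ; col-alternate = λ q → prefix-bit⇒alternates (transpose M q) (col-bit q)
    ; row-sum       = λ p → total (M p) (row-prefix p ≤-refl)
        (right (<⇒≤ (Fin.toℕ<n p))) (right (Fin.toℕ<n p))
    ; col-sum       = λ q → total (transpose M q) (col-prefix q ≤-refl)
        (bottom (<⇒≤ (Fin.toℕ<n q))) (bottom (Fin.toℕ<n q))
    }

  rank-mixedDifference : ∀ {i j} → i ≤ n → j ≤ n → rank M i j ≡ + r i j
  rank-mixedDifference {i} {j} i≤n j≤n = trans (rank-rows M i j)
    (prefix-telescope (λ p → prefix (M p) j) (λ i → + r i j) (cong +_ (top j≤n))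
      (λ p → row-prefix p j≤n) i≤n)

-- Counting inverses of monotone functions

-- Naturals are compared through their sets of smaller numbers; this reduces inequalities between
-- counts to inequalities between values.
≤-from-< : ∀ {x y} → (∀ {k} → k < x → k < y) → x ≤ y
≤-from-< {zero}  h = z≤n
≤-from-< {suc x} h = h ≤-refl

≤-suc-from-< : ∀ {x y} → (∀ {k} → suc k < x → k < y) → x ≤ suc y
≤-suc-from-< {zero}  h = z≤n
≤-suc-from-< {suc x} h = s≤s (≤-from-< (h ∘ s<s))

MonotoneBelow : ℕ → (ℕ → ℕ) → Set
MonotoneBelow n f = ∀ {a b} → a ≤ b → b < n → f a ≤ f b

steps⇒monotone : ∀ {f} → (∀ {j} → suc j < n → f j ≤ f (suc j)) → MonotoneBelow n f
steps⇒monotone {f = f} h {a} {b} a≤b b<n with m≤n⇒m<n∨m≡n a≤b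
steps⇒monotone h {b = zero}  a≤b b<n | inj₁ ()
steps⇒monotone h {b = suc b} a≤b b<n | inj₁ (s≤s a≤b′) =
  ≤-trans (steps⇒monotone h a≤b′ (<⇒≤ b<n)) (h b<n)
steps⇒monotone h a≤b b<n | inj₂ refl = ≤-refl

-- For f monotone below n, this is the number of j < n with f j < k.
below : ℕ → (ℕ → ℕ) → ℕ → ℕ
below zero    f k = 0
below (suc n) f k with f n <? k
... | yes _ = suc n
... | no  _ = below n f k

below-≤ : ∀ n f k → below n f k ≤ n
below-≤ zero    f k = z≤n
below-≤ (suc n) f k with f n <? k
... | yes _ = ≤-refl
... | no  _ = m≤n⇒m≤1+n (below-≤ n f k)

<-below : ∀ n {f k j} → j < n → f j < k → j < below n f k
<-below (suc n) {f} {k} j<1+n fj<k with f n <? k | m<1+n⇒m<n∨m≡n j<1+n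
... | yes _    | _         = j<1+n
... | no _     | inj₁ j<n  = <-below n j<n fj<k
... | no fn≮k  | inj₂ refl = contradiction fj<k fn≮k

-- The scan from the top stops at the largest argument with value below `k`, and monotonicity
-- carries this to all smaller arguments. Together with `<-below` this is a Galois connection
-- between `f` and `below n f`.
<-below⁻¹ : ∀ n {f k j} → MonotoneBelow n f → j < below n f k → f j < k
<-below⁻¹ (suc n) {f} {k} mono j<b with f n <? k
... | yes fn<k = ≤-<-trans (mono (s≤s⁻¹ j<b) ≤-refl) fn<k
... | no  _    = <-below⁻¹ n (λ a≤b b<n → mono a≤b (m<n⇒m<1+n b<n)) j<b

below-cong : ∀ n {f g} → (∀ {j} → j < n → f j ≡ g j) → ∀ k → below n f k ≡ below n g k
below-cong zero    f≗g k = refl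
below-cong (suc n) {f} {g} f≗g k with f n <? k | g n <? k
... | yes _    | yes _    = refl
... | no  _    | no  _    = below-cong n (f≗g ∘ m<n⇒m<1+n) k
... | yes fn<k | no  gn≮k = contradiction (subst (_< k) (f≗g ≤-refl) fn<k) gn≮k
... | no  fn≮k | yes gn<k = contradiction (subst (_< k) (sym (f≗g ≤-refl)) gn<k) fn≮k

-- Monotone triangles and corner sum matrices

-- N i j is the entry in row i and column j + 1 of the triangle.
record IsTriangle (m n : ℕ) (N : ℕ → ℕ → ℕ) : Set where
  field
    left-≤     : ∀ {i j} → i < m → j < i → N (suc i) j ≤ N i j
    right-≤    : ∀ {i j} → i < m → j < i → N i j ≤ N (suc i) (suc j)
    increasing : ∀ {i j} → i ≤ m → suc j < i → N i j < N i (suc j)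
    positive   : ∀ {i j} → i ≤ m → j < i → 1 ≤ N i j
    bounded    : ∀ {i j} → i ≤ m → j < i → N i j ≤ n

module _ {r : ℕ → ℕ → ℕ} (corner : IsCornerSum n r) where
  open IsCornerSum corner

  cornerSum-monotone : ∀ {i} → i ≤ n → MonotoneBelow n (r i)
  cornerSum-monotone i≤n = steps⇒monotone λ j<n → proj₁ (across i≤n (<⇒≤ j<n))

  cornerSum-≤ : ∀ {i j} → i ≤ n → j ≤ n → r i j ≤ j
  cornerSum-≤ {j = zero}  i≤n _   = ≤-reflexive (left i≤n)
  cornerSum-≤ {j = suc j} i≤n j<n =
    ≤-trans (proj₂ (across i≤n j<n)) (s≤s (cornerSum-≤ i≤n (<⇒≤ j<n)))

  -- The entry is the first column in which row `i` of `r` reaches `suc j`. The lower bound in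
  -- `down` gives `left-≤`, the upper bound gives `right-≤`, and steps of at most 1 along the row
  -- give `increasing`.
  cornerSum-triangle : ∀ {m} → m ≤ n → IsTriangle m n (λ i j → below n (r i) (suc j))
  cornerSum-triangle {m} m≤n = record
    { left-≤     = λ {i} {j} i<m j<i → ≤-from-< λ k<b →
        <-below n (inside k<b) (≤-<-trans (proj₁ (down (<-≤-trans i<m m≤n) (<⇒≤ (inside k<b))))
          (unfold (≤-trans i<m m≤n) k<b))
    ; right-≤    = λ {i} {j} i<m j<i → ≤-from-< λ k<b →
        <-below n (inside k<b) (≤-<-trans (proj₂ (down (<-≤-trans i<m m≤n) (<⇒≤ (inside k<b))))
          (s<s (unfold (≤-trans (<⇒≤ i<m) m≤n) k<b)))
    ; increasing = λ {i} {j} i≤m j<i →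
        <-below n (below-< (≤-trans i≤m m≤n) j<i) (s<s (at (≤-trans i≤m m≤n)))
    ; positive   = λ {i} {j} i≤m j<i → <-below n
        (≤-trans (≤-trans (s≤s z≤n) j<i) (≤-trans i≤m m≤n))
        (subst (_< suc j) (sym (left (≤-trans i≤m m≤n))) z<s)
    ; bounded    = λ {i} {j} _ _ → below-≤ n (r i) (suc j)
    }
    where
    inside : ∀ {i j k} → k < below n (r i) j → k < n
    inside k<b = <-≤-trans k<b (below-≤ n _ _)

    unfold : ∀ {i j k} → i ≤ n → k < below n (r i) j → r i k < j
    unfold i≤n = <-below⁻¹ n (cornerSum-monotone i≤n)

    -- One column earlier the value is at most `j`, and a step across adds at most 1.
    at : ∀ {i j} → i ≤ n → r i (below n (r i) (suc j)) ≤ suc j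
    at {i} {j} i≤n with below n (r i) (suc j) in eq
    ... | zero  = ≤-trans (≤-reflexive (left i≤n)) z≤n
    ... | suc b = ≤-trans (proj₂ (across i≤n (inside b<))) (unfold i≤n b<)
      where
      b< : b < below n (r i) (suc j)
      b< = ≤-reflexive (sym eq)

    below-< : ∀ {i j} → i ≤ n → suc j < i → below n (r i) (suc j) < n
    below-< {i} i≤n 1+j<i = ≤∧≢⇒< (below-≤ n _ _) λ eq → <⇒≱ 1+j<i
      (subst (_≤ _) (trans (cong (r i) eq) (right i≤n)) (at i≤n))

-- The rank condition on corner sums, with `m` in the role of t - 1

Saturated : ℕ → ℕ → (ℕ → ℕ → ℕ) → Set
Saturated n m r = ∀ {i j} → m ≤ i → suc i < n → j ≤ n →
  r (suc i) j ≡ suc (r i j) ⊎ r (suc i) j ≡ r (suc (suc i)) j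

module _ {r : ℕ → ℕ → ℕ} {m : ℕ} (corner : IsCornerSum n r) (saturated : Saturated n m r) where
  open IsCornerSum corner

  private
    -- After a flat step the first alternative of `Saturated` fails, so the next step is flat too,
    -- and so on to the last row, where `bottom` gives `j`. `d` counts the rows left.
    stationary : ∀ d {i j} → d + suc i ≡ n → m ≤ i → j ≤ n →
      r (suc i) j ≡ r i j → r (suc i) j ≡ j
    stationary zero    refl m≤i j≤n eq = bottom j≤n
    stationary (suc d) {i} {j} refl m≤i j≤n eq with saturated m≤i (s≤s (m≤n+m (suc i) d)) j≤n
    ... | inj₁ up   = contradiction (trans (sym up) eq) 1+n≢n
    ... | inj₂ flat = trans flat
      (stationary d (+-suc d (suc i)) (m≤n⇒m≤1+n m≤i) j≤n (sym flat))

  -- The column climbs by 1 per row until its first flat step; by `stationary` it has then reached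
  -- `j`, and by `cornerSum-≤` it never exceeds `j`.
  saturated-formula : ∀ k {j} → k + m ≤ n → j ≤ n → r (k + m) j ≡ (r m j + k) ⊓ j
  saturated-formula zero {j} m≤n j≤n = sym (trans
    (cong (_⊓ j) (+-identityʳ (r m j))) (m≤n⇒m⊓n≡m (cornerSum-≤ corner m≤n j≤n)))
  saturated-formula (suc k) {j} k+m<n j≤n
    with step-cases (down k+m<n j≤n) | saturated-formula k (<⇒≤ k+m<n) j≤n
  ... | inj₁ flat | ih = trans r≡j (sym (m≥n⇒m⊓n≡n j≤))
    where
    r≡j : r (suc k + m) j ≡ j
    r≡j = stationary (n ∸ suc (k + m)) (m∸n+n≡m k+m<n) (m≤n+m m k) j≤n flat
    j≤ : j ≤ r m j + suc k
    j≤ = begin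
      j                ≡⟨ r≡j ⟨
      r (suc k + m) j  ≡⟨ flat ⟩
      r (k + m) j      ≡⟨ ih ⟩
      (r m j + k) ⊓ j  ≤⟨ m⊓n≤m _ j ⟩
      r m j + k        ≤⟨ +-monoʳ-≤ (r m j) (n≤1+n k) ⟩
      r m j + suc k    ∎
      where open ≤-Reasoning
  ... | inj₂ up | ih with ≤-total j (r m j + k)
  -- The column already equals `j`, so a further rise would exceed `j`.
  ...   | inj₁ j≤ = contradiction
    (subst (_≤ j) (trans up (cong suc (trans ih (m≥n⇒m⊓n≡n j≤)))) (cornerSum-≤ corner k+m<n j≤n))
    1+n≰n
  ...   | inj₂ ≤j = trans r≡ (sym (m≤n⇒m⊓n≡m (subst (_≤ j) r≡ (cornerSum-≤ corner k+m<n j≤n))))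
    where
    r≡ : r (suc k + m) j ≡ r m j + suc k
    r≡ = trans up (trans (cong suc (trans ih (m≤n⇒m⊓n≡m ≤j))) (sym (+-suc (r m j) k)))

-- From triangles to saturated corner sum matrices

module _ {m n : ℕ} {N : ℕ → ℕ → ℕ} (triangle : IsTriangle m n N) where
  open IsTriangle triangle

  -- Row `i` of the corner sum matrix sought; `suc j` turns the strict comparison in `below` into a
  -- weak one.
  rowCount : ℕ → ℕ → ℕ
  rowCount i j = below i (N i) (suc j)

  private
    fold : ∀ {i j k} → k < i → N i k ≤ j → k < rowCount i j
    fold k<i N≤j = <-below _ k<i (s≤s N≤j)

    row<  : ∀ {i j k} → k < rowCount i j → k < i
    row< k< = <-≤-trans k< (below-≤ _ _ _)

    unfold : ∀ {i j k} → i ≤ m → k < rowCount i j → N i k ≤ j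
    unfold i≤m k< = s≤s⁻¹ (<-below⁻¹ _ (steps⇒monotone (<⇒≤ ∘ increasing i≤m)) k<)

  rowCount-right : ∀ {i} → i ≤ m → rowCount i n ≡ i
  rowCount-right {i} i≤m = ≤-antisym (below-≤ i _ _)
    (≤-from-< λ k<i → fold k<i (bounded i≤m k<i))

  rowCount-left : ∀ {i} → i ≤ m → rowCount i 0 ≡ 0
  rowCount-left i≤m = n≤0⇒n≡0 (≤-from-< λ k< →
    contradiction (≤-trans (positive i≤m (row< k<)) (unfold i≤m k<)) 1+n≰n)

  -- Entries in a row increase strictly, so at most one of them equals `suc j`.
  rowCount-across : ∀ {i j} → i ≤ m → Step (rowCount i j) (rowCount i (suc j))
  rowCount-across i≤m =
    ≤-from-< (λ k< → fold (row< k<) (m≤n⇒m≤1+n (unfold i≤m k<))) ,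
    ≤-suc-from-< λ k< → fold (<-trans ≤-refl (row< k<))
      (s≤s⁻¹ (≤-trans (increasing i≤m (row< k<)) (unfold i≤m k<)))

  -- Each half is one interlacing inequality: `left-≤` carries entries at most `j` from row `i` to
  -- the same position in row `suc i`, and `right-≤` carries them back, one position to the left.
  rowCount-down : ∀ {i j} → i < m → Step (rowCount i j) (rowCount (suc i) j)
  rowCount-down i<m =
    ≤-from-< (λ k< → fold (m<n⇒m<1+n (row< k<))
      (≤-trans (left-≤ i<m (row< k<)) (unfold (<⇒≤ i<m) k<))) ,
    ≤-suc-from-< λ k< → fold (s<s⁻¹ (row< k<))
      (≤-trans (right-≤ i<m (s<s⁻¹ (row< k<))) (unfold i<m k<))

  rowCount-≤ : ∀ {i} j → i ≤ m → rowCount i j ≤ j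
  rowCount-≤ zero    i≤m = ≤-reflexive (rowCount-left i≤m)
  rowCount-≤ (suc j) i≤m = ≤-trans (proj₂ (rowCount-across i≤m)) (s≤s (rowCount-≤ j i≤m))

  -- All `i` entries are at most `n`, and each of the `d` columns to the right of `j` accounts for
  -- at most one of them.
  rowCount-deficit : ∀ {i} d {j} → i ≤ m → d + j ≡ n → i ≤ rowCount i j + d
  rowCount-deficit {i} zero {j} i≤m refl =
    ≤-reflexive (sym (trans (+-identityʳ _) (rowCount-right i≤m)))
  rowCount-deficit {i} (suc d) {j} i≤m refl = begin
    i                            ≤⟨ rowCount-deficit d i≤m (+-suc d j) ⟩
    rowCount i (suc j) + d       ≤⟨ +-monoˡ-≤ d (proj₂ (rowCount-across i≤m)) ⟩
    suc (rowCount i j) + d       ≡⟨ +-suc (rowCount i j) d ⟨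
    rowCount i j + suc d         ∎
    where open ≤-Reasoning

  -- One formula for all rows: for `i ≤ m` it reduces to `rowCount i j`, and from row `m` on it is
  -- the expression forced by `saturated-formula`.
  saturation : ℕ → ℕ → ℕ
  saturation i j = (rowCount (i ⊓ m) j + (i ∸ m)) ⊓ j

  saturation-above : ∀ {i} j → i ≤ m → saturation i j ≡ rowCount i j
  saturation-above {i} j i≤m = begin
    (rowCount (i ⊓ m) j + (i ∸ m)) ⊓ j
      ≡⟨ cong₂ (λ a b → (rowCount a j + b) ⊓ j) (m≤n⇒m⊓n≡m i≤m) (m≤n⇒m∸n≡0 i≤m) ⟩
    (rowCount i j + 0) ⊓ j              ≡⟨ cong (_⊓ j) (+-identityʳ _) ⟩
    rowCount i j ⊓ j                    ≡⟨ m≤n⇒m⊓n≡m (rowCount-≤ j i≤m) ⟩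
    rowCount i j                        ∎
    where open ≡-Reasoning

  saturation-below : ∀ k j → saturation (k + m) j ≡ (rowCount m j + k) ⊓ j
  saturation-below k j = cong₂ (λ a b → (rowCount a j + b) ⊓ j)
    (m≥n⇒m⊓n≡n (m≤n+m m k)) (m+n∸n≡m k m)

  private
    step-⊓ : ∀ {a b c d} → Step a b → Step c d → Step (a ⊓ c) (b ⊓ d)
    step-⊓ (p , q) (s , t) = ⊓-mono-≤ p s , ⊓-mono-≤ q t

    step-+ : ∀ {a b} c → Step a b → Step (a + c) (b + c)
    step-+ c (p , q) = +-monoˡ-≤ c p , +-monoˡ-≤ c q

    step-refl : ∀ {a} → Step a a
    step-refl = ≤-refl , n≤1+n _

    step-suc : ∀ {a} → Step a (suc a)
    step-suc = n≤1+n _ , ≤-refl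

  saturation-isCornerSum : m ≤ n → IsCornerSum n saturation
  saturation-isCornerSum m≤n = record
    { top    = λ {j} _ → saturation-above j z≤n
    ; left   = λ {i} _ → ⊓-zeroʳ (rowCount (i ⊓ m) 0 + (i ∸ m))
    ; bottom = λ {j} j≤n → subst (λ i → saturation i j ≡ j) (m∸n+n≡m m≤n)
        (trans (saturation-below (n ∸ m) j) (m≥n⇒m⊓n≡n (full j≤n)))
    ; right  = λ {i} i≤n → trans
        (cong (λ a → (a + (i ∸ m)) ⊓ n) (rowCount-right (m⊓n≤n i m)))
        (trans (cong (_⊓ n) (trans (cong (_+ (i ∸ m)) (⊓-comm i m)) (m⊓n+n∸m≡n m i)))
          (m≤n⇒m⊓n≡m i≤n))
    ; down   = λ {i} {j} _ _ → saturation-down i j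
    ; across = λ {i} {j} _ _ → step-⊓ (step-+ (i ∸ m) (rowCount-across (m⊓n≤n i m))) step-suc
    }
    where
    -- Row `m` misses `j` by at most `n ∸ m`, so the column can reach `j` by row `n`. Adding `m` to
    -- both sides avoids truncated subtraction when `rowCount-deficit` is applied.
    full : ∀ {j} → j ≤ n → j ≤ rowCount m j + (n ∸ m)
    full {j} j≤n = +-cancelʳ-≤ m j _ (begin
      j + m                               ≤⟨ +-monoʳ-≤ j (rowCount-deficit (n ∸ j) ≤-refl (m∸n+n≡m j≤n)) ⟩
      j + (rowCount m j + (n ∸ j))        ≡⟨ +-comm j _ ⟩
      rowCount m j + (n ∸ j) + j          ≡⟨ +-assoc (rowCount m j) _ j ⟩
      rowCount m j + (n ∸ j + j)          ≡⟨ cong (λ a → rowCount m j + a) (trans (m∸n+n≡m j≤n) (sym (m∸n+n≡m m≤n))) ⟩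
      rowCount m j + (n ∸ m + m)          ≡⟨ +-assoc (rowCount m j) _ m ⟨
      rowCount m j + (n ∸ m) + m          ∎)
      where open ≤-Reasoning

    saturation-down : ∀ i j → Step (saturation i j) (saturation (suc i) j)
    saturation-down i j with ≤-<-connex m i
    ... | inj₁ m≤i = subst (λ i → Step (saturation i j) (saturation (suc i) j)) (m∸n+n≡m m≤i)
      (subst₂ Step (sym (saturation-below (i ∸ m) j))
        (sym (trans (saturation-below (suc (i ∸ m)) j)
          (cong (_⊓ j) (+-suc (rowCount m j) (i ∸ m)))))
        (step-⊓ step-suc step-refl))
    ... | inj₂ i<m = subst₂ Step (sym (saturation-above j (<⇒≤ i<m)))
      (sym (saturation-above j i<m)) (rowCount-down i<m)

  -- The unclipped value `rowCount m j + k` decides: below `j` the next row adds 1, and once it is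
  -- at least `j` the later rows are clipped to `j`.
  saturation-saturated : Saturated n m saturation
  saturation-saturated {i} {j} m≤i _ _ =
    subst (λ i → saturation (suc i) j ≡ suc (saturation i j) ⊎
                 saturation (suc i) j ≡ saturation (suc (suc i)) j) (m∸n+n≡m m≤i) step
    where
    k = i ∸ m
    step : saturation (suc k + m) j ≡ suc (saturation (k + m) j) ⊎
           saturation (suc k + m) j ≡ saturation (suc (suc k) + m) j
    step rewrite saturation-below k j | saturation-below (suc k) j | saturation-below (suc (suc k)) j
               | +-suc (rowCount m j) (suc k) | +-suc (rowCount m j) k
      with ≤-<-connex j (rowCount m j + k)
    ... | inj₁ j≤ = inj₂ (trans (m≥n⇒m⊓n≡n (m≤n⇒m≤1+n j≤))
      (sym (m≥n⇒m⊓n≡n (m≤n⇒m≤1+n (m≤n⇒m≤1+n j≤)))))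
    ... | inj₂ <j = inj₁ (trans (m≤n⇒m⊓n≡m <j) (cong suc (sym (m≤n⇒m⊓n≡m (<⇒≤ <j)))))

  -- Counting twice returns the row: `j < N i k` holds exactly when `k < rowCount i j` fails, that
  -- is, when `rowCount i j < suc k`.
  saturation-triangle : ∀ {i k} → i ≤ m → k < i → below n (saturation i) (suc k) ≡ N i k
  saturation-triangle {i} {k} i≤m k<i = trans
    (below-cong n (λ {j} _ → saturation-above j i≤m) (suc k))
    (≤-antisym
      (≤-from-< λ {j} j<b → ≰⇒> λ N≤j →
        1+n≰n (≤-trans (fold k<i N≤j) (s≤s⁻¹ (<-below⁻¹ n monotone j<b))))
      (≤-from-< λ {j} j<N → <-below n (<-≤-trans j<N (bounded i≤m k<i))
        (s≤s (≮⇒≥ λ k<count → <⇒≱ j<N (unfold i≤m k<count)))))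
    where
    monotone : MonotoneBelow n (rowCount i)
    monotone = steps⇒monotone λ _ → proj₁ (rowCount-across i≤m)

-- Integer triangles and their zero-based natural versions

fromTriangle : ∀ {m n N} → IsTriangle m n N → MonotoneTriangle m n
fromTriangle {m} {n} {N} triangle = record
  -- `pred` passes from columns counted from 1 to columns counted from 0; its value at 0 lies
  -- outside the triangle.
  { entry      = λ i j → + N i (pred j)
  ; isMonotone = record
    { interlace = λ { (suc i) (suc j) _ j<i i<m →
        ℤ.+≤+ (left-≤ i<m (s<s⁻¹ j<i)) , ℤ.+≤+ (right-≤ i<m (s<s⁻¹ j<i)) }
    ; increase  = λ { i (suc j) _ j<i i≤m → ℤ.+<+ (increasing i≤m j<i) }
    }
  ; bounded    = λ { i (suc j) _ j<i i≤m → ℤ.+≤+ (positive i≤m j<i) , ℤ.+≤+ (bounded i≤m j<i) }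
  }
  where open IsTriangle triangle

module _ {m n : ℕ} (T : MonotoneTriangle m n) where
  open MonotoneTriangle T
  open IsMonotoneTriangle isMonotone

  magnitude : ℕ → ℕ → ℕ
  magnitude i j = ℤ.∣ entry i (suc j) ∣

  -- Entries are at least 1, so absolute values lose nothing inside the triangle.
  +magnitude : ∀ {i j} → i ≤ m → j < i → + magnitude i j ≡ entry i (suc j)
  +magnitude i≤m j<i = ℤ.0≤i⇒+∣i∣≡i
    (ℤ.≤-trans (ℤ.+≤+ z≤n) (proj₁ (bounded _ _ (s≤s z≤n) j<i i≤m)))

  magnitude-triangle : IsTriangle m n magnitude
  magnitude-triangle = record
    { left-≤     = λ i<m j<i → drop (+magnitude i<m (m<n⇒m<1+n j<i)) (+magnitude (<⇒≤ i<m) j<i)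
        (proj₁ (interlace _ _ (s≤s z≤n) (s<s j<i) i<m))
    ; right-≤    = λ i<m j<i → drop (+magnitude (<⇒≤ i<m) j<i) (+magnitude i<m (s<s j<i))
        (proj₂ (interlace _ _ (s≤s z≤n) (s<s j<i) i<m))
    ; increasing = λ i≤m j<i → ℤ.drop‿+<+ (subst₂ ℤ._<_
        (sym (+magnitude i≤m (<-trans ≤-refl j<i))) (sym (+magnitude i≤m j<i))
        (increase _ _ (s≤s z≤n) j<i i≤m))
    ; positive   = λ i≤m j<i → drop refl (+magnitude i≤m j<i)
        (proj₁ (bounded _ _ (s≤s z≤n) j<i i≤m))
    ; bounded    = λ i≤m j<i → drop (+magnitude i≤m j<i) refl
        (proj₂ (bounded _ _ (s≤s z≤n) j<i i≤m))
    }
    where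
    drop : ∀ {a b x y} → + a ≡ x → + b ≡ y → x ℤ.≤ y → a ≤ b
    drop refl refl = ℤ.drop‿+≤+

-- Recovering corner sums from top rows, and the bijection

cornerSum-row-injective : ∀ {r s : ℕ → ℕ → ℕ} → IsCornerSum n r → IsCornerSum n s →
  ∀ {i} → i ≤ n → (∀ {k} → k < i → below n (r i) (suc k) ≡ below n (s i) (suc k)) →
  ∀ {j} → j ≤ n → r i j ≡ s i j
cornerSum-row-injective {n} {r} {s} R S {i} i≤n eq j≤n with m≤n⇒m<n∨m≡n j≤n
-- `below n` sees only columns below `n`; the last one is fixed by `right`.
... | inj₂ refl = trans (IsCornerSum.right R i≤n) (sym (IsCornerSum.right S i≤n))
... | inj₁ j<n  = ≤-antisym (half S R (sym ∘ eq) j<n) (half R S eq j<n)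
  where
  ≤-row : ∀ {r} → IsCornerSum n r → ∀ {j} → j < n → r i j ≤ i
  ≤-row {r} R j<n = subst (r i _ ≤_) (IsCornerSum.right R i≤n)
    (steps⇒monotone {suc n} (proj₁ ∘ IsCornerSum.across R i≤n ∘ s<s⁻¹) (<⇒≤ j<n) ≤-refl)

  -- If `r i j < s i j`, take the threshold `suc (r i j)`: column `j` is counted for `r`, hence by
  -- equality of the counts also for `s`, so `s i j ≤ r i j`.
  half : ∀ {r s} → IsCornerSum n r → IsCornerSum n s →
    (∀ {k} → k < i → below n (r i) (suc k) ≡ below n (s i) (suc k)) →
    ∀ {j} → j < n → s i j ≤ r i j
  half {r} {s} R S eq {j} j<n = ≮⇒≥ λ r<s → <⇒≱
    (<-below⁻¹ n (cornerSum-monotone S i≤n)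
      (subst (j <_) (eq (<-≤-trans r<s (≤-row S j<n))) (<-below n j<n ≤-refl)))
    r<s

module _ {n m : ℕ} (A : ASM^ (suc n) (interval (suc n) (suc m))) where
  open ASM^ A

  private
    r = cornerSum matrix
    corner = cornerSum-isCornerSum isASM

  -- With t = `suc m`, the bounds on `i` say that row `suc i` belongs to the index set. The rank
  -- condition starts at column 1, so column 0 is settled by `left`.
  cornerSum-saturated : Saturated (suc n) m r
  cornerSum-saturated {i} {zero} _ i<n _ =
    inj₂ (trans (IsCornerSum.left corner (<⇒≤ i<n)) (sym (IsCornerSum.left corner i<n)))
  cornerSum-saturated {i} {suc j} m≤i i<n j<n = subst₂ Claim
    (Fin.toℕ-fromℕ< (s<s⁻¹ i<n)) (Fin.toℕ-fromℕ< j<n)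
    (claim (rank-I p (s≤s (subst (m ≤_) (sym (Fin.toℕ-fromℕ< (s<s⁻¹ i<n))) m≤i) , Fin.toℕ<n p) q))
    where
    p : Fin n
    p = fromℕ< (s<s⁻¹ i<n)
    q : Fin (suc n)
    q = fromℕ< j<n
    Claim : ℕ → ℕ → Set
    Claim i j = r (suc i) (suc j) ≡ suc (r i (suc j)) ⊎ r (suc i) (suc j) ≡ r (suc (suc i)) (suc j)
    claim : rank matrix (pos p) (pos q) ≡ rank matrix (toℕ p) (pos q) ℤ.+ 1ℤ ⊎
      rank matrix (pos p) (pos q) ≡ rank matrix (suc (pos p)) (pos q) → Claim (toℕ p) (toℕ q)
    claim (inj₂ flat) = inj₂ (cong ℤ.∣_∣ flat)
    claim (inj₁ up)   = inj₁ (ℤ.+-injective (begin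
      + r (pos p) (pos q)                    ≡⟨ +cornerSum isASM (m≤n⇒m≤1+n (Fin.toℕ<n p)) (pos q) ⟩
      rank matrix (pos p) (pos q)            ≡⟨ up ⟩
      rank matrix (toℕ p) (pos q) ℤ.+ 1ℤ     ≡⟨ cong (ℤ._+ 1ℤ) (+cornerSum isASM (m≤n⇒m≤1+n (<⇒≤ (Fin.toℕ<n p))) (pos q)) ⟨
      + r (toℕ p) (pos q) ℤ.+ 1ℤ             ≡⟨ ℤ.+-comm (+ r (toℕ p) (pos q)) 1ℤ ⟩
      + suc (r (toℕ p) (pos q))              ∎))
      where open ≡-Reasoning

  topTriangle : m ≤ suc n → MonotoneTriangle m (suc n)
  topTriangle m≤n = fromTriangle (cornerSum-triangle corner m≤n)

saturated⇒ASM : ∀ {n m r} → IsCornerSum (suc n) r → Saturated (suc n) m r →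
  ASM^ (suc n) (interval (suc n) (suc m))
saturated⇒ASM {n} {m} {r} corner saturated = record
  { matrix = mixedDifference r
  ; isASM  = mixedDifference-isASM corner
  ; rank-I = λ i (t≤i , _) j → convert (m≤n⇒m≤1+n (Fin.toℕ<n i)) (s≤s (Fin.toℕ<n i)) (Fin.toℕ<n j)
      (saturated (s≤s⁻¹ t≤i) (s<s (Fin.toℕ<n i)) (Fin.toℕ<n j))
  }
  where
  M : Matrix (suc n)
  M = mixedDifference r
  convert : ∀ {i j} → suc i ≤ suc n → suc (suc i) ≤ suc n → j ≤ suc n →
    r (suc i) j ≡ suc (r i j) ⊎ r (suc i) j ≡ r (suc (suc i)) j →
    rank M (suc i) j ≡ rank M i j ℤ.+ 1ℤ ⊎ rank M (suc i) j ≡ rank M (suc (suc i)) j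
  convert {i} {j} i<n 1+i<n j≤n
    rewrite rank-mixedDifference corner (<⇒≤ i<n) j≤n
          | rank-mixedDifference corner i<n j≤n
          | rank-mixedDifference corner 1+i<n j≤n = λ
    { (inj₁ up)   → inj₁ (trans (cong +_ up) (ℤ.+-comm 1ℤ (+ r i j)))
    ; (inj₂ flat) → inj₂ (cong +_ flat) }

-- The triangle fixes the corner sums in rows up to `m`, `saturated-formula` then fixes the later
-- rows, and ranks determine the matrix.
topTriangle-injective : ∀ {n m} (m≤n : m ≤ suc n)
  (A B : ASM^ (suc n) (interval (suc n) (suc m))) →
  Setoid._≈_ (MonotoneTriangle-setoid m (suc n)) (topTriangle A m≤n) (topTriangle B m≤n) →
  ∀ p q → ASM^.matrix A p q ≡ ASM^.matrix B p q
topTriangle-injective {n} {m} m≤n A B eq = rank-injective λ {i} {j} i≤n j≤n → begin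
  rank A.matrix i j           ≡⟨ +cornerSum A.isASM i≤n j ⟨
  + cornerSum A.matrix i j    ≡⟨ cong +_ (agree i≤n j≤n) ⟩
  + cornerSum B.matrix i j    ≡⟨ +cornerSum B.isASM i≤n j ⟩
  rank B.matrix i j           ∎
  where
  open ≡-Reasoning
  module A = ASM^ A
  module B = ASM^ B
  rA = cornerSum A.matrix
  rB = cornerSum B.matrix
  cA = cornerSum-isCornerSum A.isASM
  cB = cornerSum-isCornerSum B.isASM

  agree-top : ∀ {i j} → i ≤ m → j ≤ suc n → rA i j ≡ rB i j
  agree-top i≤m = cornerSum-row-injective cA cB (≤-trans i≤m m≤n)
    λ k<i → ℤ.+-injective (eq _ _ (s≤s z≤n) k<i i≤m)

  agree : ∀ {i j} → i ≤ suc n → j ≤ suc n → rA i j ≡ rB i j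
  agree {i} {j} i≤n j≤n with ≤-total i m
  ... | inj₁ i≤m = agree-top i≤m j≤n
  ... | inj₂ m≤i = subst (λ i → rA i j ≡ rB i j) (m∸n+n≡m m≤i) (begin
    rA (k + m) j       ≡⟨ saturated-formula cA (cornerSum-saturated A) k k+m≤n j≤n ⟩
    (rA m j + k) ⊓ j   ≡⟨ cong (λ a → (a + k) ⊓ j) (agree-top ≤-refl j≤n) ⟩
    (rB m j + k) ⊓ j   ≡⟨ saturated-formula cB (cornerSum-saturated B) k k+m≤n j≤n ⟨
    rB (k + m) j       ∎)
    where
    k = i ∸ m
    k+m≤n : k + m ≤ suc n
    k+m≤n = ≤-trans (≤-reflexive (m∸n+n≡m m≤i)) i≤n

-- The preimage is the mixed difference of `saturation`: its ranks give `saturation` back, and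
-- counting there returns the entries of `T`.
topTriangle-surjective : ∀ {n m} (m≤n : m ≤ suc n) (T : MonotoneTriangle m (suc n)) →
  Σ (ASM^ (suc n) (interval (suc n) (suc m))) λ A →
    Setoid._≈_ (MonotoneTriangle-setoid m (suc n)) (topTriangle A m≤n) T
topTriangle-surjective {n} {m} m≤n T = saturated⇒ASM corner (saturation-saturated triangle) ,
  λ { i (suc j) _ j<i i≤m → trans
        (cong +_ (trans
          (below-cong (suc n)
            (λ {k} k<n → cong ℤ.∣_∣ (rank-mixedDifference corner (≤-trans i≤m m≤n) (<⇒≤ k<n)))
            (suc j))
          (saturation-triangle triangle i≤m j<i)))
        (+magnitude T i≤m j<i) }
  where
  triangle = magnitude-triangle T
  corner = saturation-isCornerSum triangle m≤n

proposition1p3 : (n t : ℕ) → 2 ≤ n → 1 ≤ t → t ≤ n ∸ 1 →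
    Bijection (ASM^-setoid n (interval n t)) (MonotoneTriangle-setoid (t ∸ 1) n)
proposition1p3 (suc n) (suc m) _ _ t≤n = record
  { to        = λ A → topTriangle A m≤n
  ; cong      = λ {A} {B} → topTriangle-cong {A} {B}
  ; bijective = (λ {A} {B} → topTriangle-injective m≤n A B)
              -- Surjectivity is asked for every representative `B` of the preimage, so `A≈T` is
              -- combined with congruence.
              , λ T → let A , A≈T = topTriangle-surjective m≤n T in A , λ {B} B≈A →
                  Setoid.trans triangles {topTriangle B m≤n} {topTriangle A m≤n} {T}
                    (topTriangle-cong {B} {A} B≈A) A≈T
  }
  where
  triangles = MonotoneTriangle-setoid m (suc n)
  open Setoid (ASM^-setoid (suc n) (interval (suc n) (suc m))) using () renaming (_≈_ to _≈ᴬ_)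
  open Setoid triangles using () renaming (_≈_ to _≈ᵀ_)

  m≤n : m ≤ suc n
  m≤n = m≤n⇒m≤1+n (<⇒≤ t≤n)

  topTriangle-cong : ∀ {A B} → A ≈ᴬ B → topTriangle A m≤n ≈ᵀ topTriangle B m≤n
  topTriangle-cong A≈B i j _ _ _ = cong +_
    (below-cong (suc n) (λ {k} _ → cong ℤ.∣_∣ (rank-cong A≈B i k)) (suc (pred j)))
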